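{- Let $P$ be a poset. Then $P\in\mathcal{L}_{\mathcal{S}}(<\omega)$ if and only if $B(P)\in\mathcal{L}_{\mathcal{S}}(<\omega)$.
   Context: A poset (or its order) is scattered if it contains no induced subposet isomorphic to the chain of rational numbers. $\mathcal{L}_{\mathcal{S}}(<\omega)$ is the class of posets whose order is the intersection of finitely many scattered linear orders on the underlying set. For a poset $P$, the split $B(P)$ is the poset with underlying set $P\times\{0,1\}$ and strict order $(x,i)<(y,j)$ iff $x\leq y$ in $P$ and $i<j$. -}

module Defs where

open import Level using (Level; _⊔_) renaming (suc to lsuc)
open import Data.Fin.Base using (Fin; _<_)
open import Data.Fin.Properties using (<-trans; <-irrefl)
open import Data.Nat.Base using (ℕ)
open import Data.Product using (∃-syntax; Σ-syntax; _×_; _,_)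
open import Data.Product.Relation.Binary.Pointwise.NonDependent
  using (×-isEquivalence) renaming (Pointwise to ×-Pointwise)
import Data.Rational.Base as ℚ
open import Function.Bundles using (_⇔_)
open import Relation.Binary.Bundles using (Poset; StrictPartialOrder)
open import Relation.Binary.Core using (Rel)
open import Relation.Binary.Morphism.Structures using (IsOrderMonomorphism)
import Relation.Binary.Properties.StrictPartialOrder as StrictPartialOrderProperties
open import Relation.Binary.PropositionalEquality
  using (_≡_; refl) renaming (isEquivalence to ≡-isEquivalence)
open import Relation.Binary.Structures using (IsTotalOrder)
open import Relation.Nullary using (¬_)

private
  variable
    a c ℓ₁ ℓ₂ : Level

-- An induced subposet isomorphic to (ℚ , ≤) is the image of a map that both
-- preserves and reflects ≈ and ≤.
Scattered : {A : Set a} → Rel A ℓ₁ → Rel A ℓ₂ → Set (a ⊔ ℓ₁ ⊔ ℓ₂)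
Scattered {A = A} _≈_ _≤_ =
  ¬ (∃[ f ] IsOrderMonomorphism {A = ℚ.ℚ} {B = A} _≡_ _≈_ ℚ._≤_ _≤_ f)

record IsScatteredLinearOrder {A : Set a} (_≈_ : Rel A ℓ₁) (_≤_ : Rel A ℓ₂)
                              : Set (a ⊔ ℓ₁ ⊔ ℓ₂) where
  field
    isTotalOrder : IsTotalOrder _≈_ _≤_
    scattered    : Scattered _≈_ _≤_

-- Membership in 𝓛_𝓢(<ω).  The empty intersection (n = 0) is the full
-- relation, which is the order of P only if P has at most one element; such a
-- P is also the intersection of one scattered linear order, namely its own.
𝓛ₛ<ω : Poset c ℓ₁ ℓ₂ → Set (c ⊔ ℓ₁ ⊔ lsuc ℓ₂)
𝓛ₛ<ω {ℓ₂ = ℓ₂} P =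
  Σ[ n ∈ ℕ ] Σ[ L ∈ (Fin n → Rel Carrier ℓ₂) ]
    ((∀ (i : Fin n) → IsScatteredLinearOrder _≈_ (L i))
     × (∀ x y → x ≤ y ⇔ (∀ (i : Fin n) → L i x y)))
  where
  open Poset P

split-strictPartialOrder : Poset c ℓ₁ ℓ₂ → StrictPartialOrder c ℓ₁ ℓ₂
split-strictPartialOrder P = record
  { Carrier = Carrier × Fin 2
  ; _≈_     = ×-Pointwise _≈_ _≡_
  ; _<_     = ×-Pointwise _≤_ _<_
  ; isStrictPartialOrder = record
    { isEquivalence = ×-isEquivalence isEquivalence ≡-isEquivalence
    ; irrefl        = λ (_ , i≡j) (_ , i<j) → <-irrefl i≡j i<j
    ; trans         = λ (x≤y , i<j) (y≤z , j<k) → trans x≤y y≤z , <-trans i<j j<k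
    ; <-resp-≈      =
        (λ { (y≈z , refl) (x≤y , i<j) → ≤-respʳ-≈ y≈z x≤y , i<j })
      , (λ { (y≈z , refl) (y≤x , i<j) → ≤-respˡ-≈ y≈z y≤x , i<j })
    }
  }
  where open Poset P

B : Poset c ℓ₁ ℓ₂ → Poset c ℓ₁ (ℓ₁ ⊔ ℓ₂)
B P = StrictPartialOrderProperties.poset (split-strictPartialOrder P)

{-# OPTIONS --safe #-}

-- Scatteredness makes sense for total preorders, and it is preserved by
-- pullbacks, reversal, finite lexicographic products, and by passing from a
-- scattered chain M to the inclusion order on any family of down-sets of M.
--
-- If P is the intersection of L₁, …, Lₙ, then B(P) is the intersection of the
-- lexicographic orders "Lᵢ first, then the level" together with the two orders
-- "level first, then L" and "level first, then the reverse of L", where L is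
-- the lexicographic product of all the Lᵢ.
--
-- If B(P) is the intersection of M₁, …, Mₙ, let Dᵢ(x) be the down-set of Mᵢ
-- generated by the (z , 0) with z ≤ x.  Then x ≤ y implies Dᵢ(x) ⊆ Dᵢ(y), and
-- Dᵢ(x) ⊆ Dᵢ(y) implies (x , 0) ≤ (y , 1) in Mᵢ.  So P is the intersection of
-- the total preorders Cᵢ given by inclusion of the Dᵢ, and breaking the ties of
-- each Cᵢ lexicographically by C₁, …, Cₙ makes them linear.

module Submission where

open import Defs
open import Axiom.ExcludedMiddle using (ExcludedMiddle)
open import Data.Fin.Base as Fin using (Fin; zero; suc)
import Data.Fin.Properties as Fin
open import Data.Integer.Base using (+0; +[1+_]; -[1+_]; +<+; -<-)
open import Data.Nat.Base as ℕ using (ℕ; zero; suc; s≤s; s<s; z≤n; z<s)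
import Data.Nat.Properties as ℕ
open import Data.Nat.Tactic.RingSolver using (solve-∀)
open import Data.Product using (∃-syntax; _×_; _,_; proj₁; proj₂)
open import Data.Rational.Base as ℚ using (ℚ; mkℚ; *<*; 0ℚ; ½; 1ℚ)
import Data.Rational.Properties as ℚ
open import Data.Sum.Base as Sum using (inj₁; inj₂)
open import Data.Unit.Polymorphic.Base using (⊤; tt)
open import Function.Base using (flip; _∘_; _on_)
open import Function.Bundles using (_⇔_; mk⇔; Equivalence)
open import Level using (Level; _⊔_; Lift; lift; lower)
open import Relation.Binary.Bundles using (Poset)
open import Relation.Binary.Core using (Rel)
open import Relation.Binary.Definitions
  using (Transitive; Total; Decidable; tri<; tri≈; tri>)
open import Relation.Binary.Morphism.Structures using (IsOrderMonomorphism)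
open import Relation.Binary.PropositionalEquality using (_≡_; refl; subst₂)
open import Relation.Binary.Structures using (IsTotalOrder)
open import Relation.Nullary using (¬_; yes; no; contradiction)
open import Relation.Nullary.Decidable
  using (map′; True; toWitness; fromWitness; decidable-stable; _×-dec_; _→-dec_)
open import Relation.Unary using (Pred)

private
  variable
    a b c ℓ ℓ₁ ℓ₂ : Level
    A X : Set a

-- Disjoint rational intervals indexed in order by ℚ

-- Nodes of the infinite binary tree, compared in order.
data Node : Set where
  here       : Node
  left right : Node → Node

data _≺_ : Rel Node Level.zero where
  left≺here   : ∀ {s} → left s ≺ here
  here≺right  : ∀ {t} → here ≺ right t
  left≺right  : ∀ {s t} → left s ≺ right t
  left≺left   : ∀ {s t} → s ≺ t → left s ≺ left t
  right≺right : ∀ {s t} → s ≺ t → right s ≺ right t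

-- The node of (m + 1) / (n + 1) in the Stern–Brocot tree; the first argument is
-- fuel, and any value above m + n gives the same result.
sternBrocot : ℕ → ℕ → ℕ → Node
sternBrocot zero    _ _ = here
sternBrocot (suc k) m n with ℕ.compare m n
... | ℕ.less    m j = left (sternBrocot k m j)
... | ℕ.equal   _   = here
... | ℕ.greater n j = right (sternBrocot k j n)

-- Read as fractions, the first is at least 1 and the second at most 1.
cross-≥ : ∀ {m n m′ n′} → n ℕ.≤ m → m′ ℕ.≤ n′ →
          ¬ suc m ℕ.* suc n′ ℕ.< suc m′ ℕ.* suc n
cross-≥ {m} {n′ = n′} n≤m m′≤n′ lt = ℕ.<⇒≱ lt
  (ℕ.≤-trans (ℕ.*-mono-≤ (s≤s m′≤n′) (s≤s n≤m))
             (ℕ.≤-reflexive (ℕ.*-comm (suc n′) (suc m))))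

-- Cross-multiplying `a/(a+b) < a′/(a′+b′)` gives the term `a a′` on both sides; cancelling it
-- leaves `a/b < a′/b′`, the comparison after a left turn.
cross-left : ∀ m j m′ j′ →
             suc m ℕ.* suc (suc (m′ ℕ.+ j′)) ℕ.< suc m′ ℕ.* suc (suc (m ℕ.+ j)) →
             suc m ℕ.* suc j′ ℕ.< suc m′ ℕ.* suc j
cross-left m j m′ j′ lt = ℕ.+-cancelˡ-< (suc m ℕ.* suc m′) _ _
  (subst₂ ℕ._<_ (lhs m m′ j′) (rhs m m′ j) lt)
  where
  lhs : ∀ m m′ j′ → suc m ℕ.* suc (suc (m′ ℕ.+ j′)) ≡
                    suc m ℕ.* suc m′ ℕ.+ suc m ℕ.* suc j′
  lhs = solve-∀
  rhs : ∀ m m′ j → suc m′ ℕ.* suc (suc (m ℕ.+ j)) ≡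
                   suc m ℕ.* suc m′ ℕ.+ suc m′ ℕ.* suc j
  rhs = solve-∀

-- A right turn subtracts 1 from both fractions.
cross-right : ∀ n j n′ j′ →
              suc (suc (n ℕ.+ j)) ℕ.* suc n′ ℕ.< suc (suc (n′ ℕ.+ j′)) ℕ.* suc n →
              suc j ℕ.* suc n′ ℕ.< suc j′ ℕ.* suc n
cross-right n j n′ j′ lt = ℕ.+-cancelˡ-< (suc n ℕ.* suc n′) _ _
  (subst₂ ℕ._<_ (lhs n n′ j) (rhs n n′ j′) lt)
  where
  lhs : ∀ n n′ j → suc (suc (n ℕ.+ j)) ℕ.* suc n′ ≡
                   suc n ℕ.* suc n′ ℕ.+ suc j ℕ.* suc n′
  lhs = solve-∀
  rhs : ∀ n n′ j′ → suc (suc (n′ ℕ.+ j′)) ℕ.* suc n ≡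
                    suc n ℕ.* suc n′ ℕ.+ suc j′ ℕ.* suc n
  rhs = solve-∀

-- Fractions on the same side of 1 take the same turn, and one step of Euclid's subtractive
-- algorithm keeps their order. In the remaining cases 1 lies weakly between them, and `cross-≥`
-- refutes the wrong order.
sternBrocot-mono : ∀ k k′ m n m′ n′ → m ℕ.+ n ℕ.< k → m′ ℕ.+ n′ ℕ.< k′ →
                   suc m ℕ.* suc n′ ℕ.< suc m′ ℕ.* suc n →
                   sternBrocot k m n ≺ sternBrocot k′ m′ n′
sternBrocot-mono (suc k) (suc k′) m n m′ n′ (s≤s m+n≤k) (s≤s m′+n′≤k′) lt
  with ℕ.compare m n | ℕ.compare m′ n′
... | ℕ.less m j | ℕ.less m′ j′ = left≺left
  (sternBrocot-mono k k′ m j m′ j′ (fuel m j m+n≤k) (fuel m′ j′ m′+n′≤k′)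
    (cross-left m j m′ j′ lt))
  where
  -- The subtraction removes `suc m` from the sum, which pays for the unit of fuel.
  fuel : ∀ m j {k} → m ℕ.+ suc (m ℕ.+ j) ℕ.≤ k → m ℕ.+ j ℕ.< k
  fuel m j = ℕ.≤-trans (ℕ.m≤n+m (suc (m ℕ.+ j)) m)
... | ℕ.less _ _    | ℕ.equal _     = left≺here
... | ℕ.less _ _    | ℕ.greater _ _ = left≺right
... | ℕ.equal _     | ℕ.less m′ j′  =
  contradiction lt (cross-≥ ℕ.≤-refl (ℕ.m≤n⇒m≤1+n (ℕ.m≤m+n m′ j′)))
... | ℕ.equal m     | ℕ.equal m′    =
  contradiction lt (cross-≥ {m} {m} {m′} {m′} ℕ.≤-refl ℕ.≤-refl)
... | ℕ.equal _     | ℕ.greater _ _ = here≺right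
... | ℕ.greater n j | ℕ.less m′ j′  = contradiction lt
  (cross-≥ (ℕ.m≤n⇒m≤1+n (ℕ.m≤m+n n j)) (ℕ.m≤n⇒m≤1+n (ℕ.m≤m+n m′ j′)))
... | ℕ.greater n j | ℕ.equal _     =
  contradiction lt (cross-≥ (ℕ.m≤n⇒m≤1+n (ℕ.m≤m+n n j)) ℕ.≤-refl)
... | ℕ.greater n j | ℕ.greater n′ j′ = right≺right
  (sternBrocot-mono k k′ j n j′ n′ (fuel n j m+n≤k) (fuel n′ j′ m′+n′≤k′)
    (cross-right n j n′ j′ lt))
  where
  fuel : ∀ n j {k} → suc (n ℕ.+ j) ℕ.+ n ℕ.≤ k → j ℕ.+ n ℕ.< k
  fuel n j = ℕ.≤-trans (s≤s (ℕ.+-monoˡ-≤ n (ℕ.m≤n+m j n)))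

-- The negative rational −p/d is placed by its negative reciprocal d/p.
node : ℚ → Node
node (mkℚ -[1+ m ] n _) = left (sternBrocot (suc (n ℕ.+ m)) n m)
node (mkℚ +0       n _) = here
node (mkℚ +[1+ m ] n _) = right (sternBrocot (suc (m ℕ.+ n)) m n)

node-mono : ∀ {p q} → p ℚ.< q → node p ≺ node q
-- Taking negative reciprocals is increasing on the negative rationals; `s<s` restores the successor
-- hidden by `-[1+_]`.
node-mono {mkℚ -[1+ m ] n _} {mkℚ -[1+ m′ ] n′ _} (*<* (-<- lt)) =
  left≺left (sternBrocot-mono _ _ n m n′ m′ ℕ.≤-refl ℕ.≤-refl
    (subst₂ ℕ._<_ (ℕ.*-comm (suc m′) (suc n)) (ℕ.*-comm (suc m) (suc n′)) (s<s lt)))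
node-mono {mkℚ -[1+ _ ] _ _} {mkℚ +0       _ _} _ = left≺here
node-mono {mkℚ -[1+ _ ] _ _} {mkℚ +[1+ _ ] _ _} _ = left≺right
node-mono {mkℚ +0       _ _} {mkℚ +0       _ _} (*<* (+<+ ()))
node-mono {mkℚ +0       _ _} {mkℚ +[1+ _ ] _ _} _ = here≺right
node-mono {mkℚ +[1+ _ ] _ _} {mkℚ +0       _ _} (*<* (+<+ ()))
node-mono {mkℚ +[1+ m ] n _} {mkℚ +[1+ m′ ] n′ _} (*<* (+<+ lt)) =
  right≺right (sternBrocot-mono _ _ m n m′ n′ ℕ.≤-refl ℕ.≤-refl lt)

record Subinterval (lo hi : ℚ) : Set where
  field
    lower upper : ℚ
    lo<lower    : lo ℚ.< lower
    lower<upper : lower ℚ.< upper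
    upper<hi    : upper ℚ.< hi

open Subinterval

middle : ∀ {lo hi} → lo ℚ.< hi → Subinterval lo hi
middle lo<hi with u , lo<u , u<hi ← ℚ.<-dense lo<hi
             with v , u<v , v<hi ← ℚ.<-dense u<hi = record
  { lower = u ; upper = v ; lo<lower = lo<u ; lower<upper = u<v ; upper<hi = v<hi }

-- As with the gaps of the Cantor set, the root takes a middle piece and the subtrees share the two
-- outer ones.
subinterval : ∀ {lo hi} → lo ℚ.< hi → Node → Subinterval lo hi
subinterval lo<hi here = middle lo<hi
subinterval lo<hi (left s) = record
  { lo<lower    = lo<lower I
  ; lower<upper = lower<upper I
  ; upper<hi    = ℚ.<-trans (upper<hi I) (ℚ.<-trans (lower<upper M) (upper<hi M))
  }
  where
  M = middle lo<hi
  I = subinterval (lo<lower M) s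
subinterval lo<hi (right s) = record
  { lo<lower    = ℚ.<-trans (ℚ.<-trans (lo<lower M) (lower<upper M)) (lo<lower I)
  ; lower<upper = lower<upper I
  ; upper<hi    = upper<hi I
  }
  where
  M = middle lo<hi
  I = subinterval (upper<hi M) s

subinterval-mono : ∀ {lo hi} (lo<hi : lo ℚ.< hi) {s t} → s ≺ t →
                   upper (subinterval lo<hi s) ℚ.< lower (subinterval lo<hi t)
subinterval-mono lo<hi (left≺here {s}) =
  upper<hi (subinterval (lo<lower (middle lo<hi)) s)
subinterval-mono lo<hi (here≺right {t}) =
  lo<lower (subinterval (upper<hi (middle lo<hi)) t)
subinterval-mono lo<hi (left≺right {s} {t}) =
  ℚ.<-trans (upper<hi (subinterval (lo<lower M) s))
    (ℚ.<-trans (lower<upper M) (lo<lower (subinterval (upper<hi M) t)))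
  where M = middle lo<hi
subinterval-mono lo<hi (left≺left s≺t)   = subinterval-mono _ s≺t
subinterval-mono lo<hi (right≺right s≺t) = subinterval-mono _ s≺t

-- The ends of the cells embed the lexicographic product of ℚ with a two-element chain between `lo`
-- and `hi`.
cell : ∀ {lo hi} → lo ℚ.< hi → ℚ → Subinterval lo hi
cell lo<hi q = subinterval lo<hi (node q)

cell-mono : ∀ {lo hi} (lo<hi : lo ℚ.< hi) {p q} → p ℚ.< q →
            upper (cell lo<hi p) ℚ.< lower (cell lo<hi q)
cell-mono lo<hi p<q = subinterval-mono lo<hi (node-mono p<q)

cell-lower-mono : ∀ {lo hi} (lo<hi : lo ℚ.< hi) {p q} → p ℚ.< q →
                  lower (cell lo<hi p) ℚ.< lower (cell lo<hi q)
cell-lower-mono lo<hi {p} p<q =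
  ℚ.<-trans (lower<upper (cell lo<hi p)) (cell-mono lo<hi p<q)

0<½ : 0ℚ ℚ.< ½
0<½ = *<* (+<+ z<s)

½<1 : ½ ℚ.< 1ℚ
½<1 = *<* (+<+ (s<s z<s))

-- Scattered total preorders

-- For a total preorder this negation is strict increase, expressed without an equality on `A`.
Increasing : Rel A ℓ → (ℚ → A) → Set ℓ
Increasing R f = ∀ {p q} → p ℚ.< q → ¬ R (f q) (f p)

record IsScatteredTotalPreorder {A : Set a} (R : Rel A ℓ) : Set (a ⊔ ℓ) where
  field
    trans         : Transitive R
    total         : Total R
    dec           : Decidable R
    no-increasing : ∀ f → ¬ Increasing R f

  refl′ : ∀ x → R x x
  refl′ x = Sum.reduce (total x x)

  ≰⇒≥ : ∀ {x y} → ¬ R x y → R y x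
  ≰⇒≥ {x} {y} ¬Rxy with total x y
  ... | inj₁ Rxy = contradiction Rxy ¬Rxy
  ... | inj₂ Ryx = Ryx

open IsScatteredTotalPreorder

on-scattered : {R : Rel A ℓ} (h : X → A) →
               IsScatteredTotalPreorder R → IsScatteredTotalPreorder (R on h)
on-scattered h R-s = record
  { trans         = trans R-s
  ; total         = λ x y → total R-s (h x) (h y)
  ; dec           = λ x y → dec R-s (h x) (h y)
  ; no-increasing = λ f → no-increasing R-s (h ∘ f)
  }

flip-scattered : {R : Rel A ℓ} →
                 IsScatteredTotalPreorder R → IsScatteredTotalPreorder (flip R)
flip-scattered R-s = record
  { trans         = flip (trans R-s)
  ; total         = flip (total R-s)
  ; dec           = flip (dec R-s)
  ; no-increasing = λ f inc →
      no-increasing R-s (f ∘ ℚ.-_) (inc ∘ ℚ.neg-antimono-<)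
  }

Fin2-scattered : IsScatteredTotalPreorder (Fin._≤_ {2} {2})
Fin2-scattered = record
  { trans         = Fin.≤-trans
  ; total         = Fin.≤-total
  ; dec           = Fin._≤?_
  -- Three points suffice: after one strict rise the value is already the top of `Fin 2`.
  ; no-increasing = λ f inc → inc ½<1 (top (f 0ℚ) (f ½) (f 1ℚ) (inc 0<½))
  }
  where
  top : (i j k : Fin 2) → ¬ j Fin.≤ i → k Fin.≤ j
  top i zero       k          j≰i = contradiction z≤n j≰i
  top i (suc zero) zero       _   = z≤n
  top i (suc zero) (suc zero) _   = ℕ.≤-refl

-- Lexicographic products

Lex : Rel A ℓ₁ → Rel A ℓ₂ → Rel A (ℓ₁ ⊔ ℓ₂)
Lex R S x y = R x y × (R y x → S x y)

Lex-scattered : {R : Rel A ℓ₁} {S : Rel A ℓ₂} →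
                IsScatteredTotalPreorder R → IsScatteredTotalPreorder S →
                IsScatteredTotalPreorder (Lex R S)
Lex-scattered {R = R} {S = S} R-s S-s = record
  -- An `R`-tie between the ends closes a cycle through `x`, `y`, `z`, so both steps are ties.
  { trans = λ (Rxy , Sxy) (Ryz , Syz) → trans R-s Rxy Ryz , λ Rzx →
      trans S-s (Sxy (trans R-s Ryz Rzx)) (Syz (trans R-s Rzx Rxy))
  ; total = lex-total
  ; dec = λ x y → dec R-s x y ×-dec (dec R-s y x →-dec dec S-s x y)
  ; no-increasing = lex-no-increasing
  }
  where
  lex-total : Total (Lex R S)
  lex-total x y with dec R-s x y | dec R-s y x
  ... | no ¬Rxy | _       = inj₂ (≰⇒≥ R-s ¬Rxy , λ Rxy → contradiction Rxy ¬Rxy)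
  ... | yes Rxy | no ¬Ryx = inj₁ (Rxy , λ Ryx → contradiction Ryx ¬Ryx)
  ... | yes Rxy | yes Ryx =
    Sum.map (λ Sxy → Rxy , λ _ → Sxy) (λ Syx → Ryx , λ _ → Syx) (total S-s x y)

  -- An increasing map is R-increasing unless two of its values f p, f q are
  -- R-equivalent; then it is S-increasing on the interval from p to q.
  lex-no-increasing : ∀ f → ¬ Increasing (Lex R S) f
  lex-no-increasing f inc = no-increasing R-s f R-increasing
    where
    R-mono : ∀ {p q} → p ℚ.< q → R (f p) (f q)
    R-mono {p} {q} p<q with lex-total (f p) (f q)
    ... | inj₁ (Rpq , _) = Rpq
    ... | inj₂ Lqp       = contradiction Lqp (inc p<q)

    R-increasing : Increasing R f
    R-increasing p<q Rqp = no-increasing S-s (f ∘ lower ∘ cell p<q) λ {r} {s} r<s Ssr →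
      inc (cell-lower-mono p<q r<s)
        ( trans R-s (R-mono (ℚ.<-trans (lower<upper (cell p<q s)) (upper<hi (cell p<q s))))
            (trans R-s Rqp (R-mono (lo<lower (cell p<q r))))
        , λ _ → Ssr)

LexAll : ∀ {n} → (Fin n → Rel A ℓ) → Rel A ℓ
LexAll {n = zero}  R _ _ = ⊤
LexAll {n = suc n} R     = Lex (R zero) (LexAll (R ∘ suc))

LexAll-scattered : ∀ {n} {R : Fin n → Rel A ℓ} →
                   (∀ i → IsScatteredTotalPreorder (R i)) →
                   IsScatteredTotalPreorder (LexAll R)
LexAll-scattered {n = zero} _ = record
  { trans         = λ _ _ → tt
  ; total         = λ _ _ → inj₁ tt
  ; dec           = λ _ _ → yes tt
  ; no-increasing = λ f inc → inc 0<½ tt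
  }
LexAll-scattered {n = suc n} R-s =
  Lex-scattered (R-s zero) (LexAll-scattered (R-s ∘ suc))

all⇒LexAll : ∀ {n} (R : Fin n → Rel A ℓ) {x y} → (∀ i → R i x y) → LexAll R x y
all⇒LexAll {n = zero}  R _   = tt
all⇒LexAll {n = suc n} R Rxy = Rxy zero , λ _ → all⇒LexAll (R ∘ suc) (Rxy ∘ suc)

-- A tie in one factor passes the comparison on to the next, so a tie of the product descends
-- through all factors.
LexAll-antisym : ∀ {n} (R : Fin n → Rel A ℓ) {x y} →
                 LexAll R x y → LexAll R y x → ∀ i → R i x y
LexAll-antisym R (Rxy , _) _         zero    = Rxy
LexAll-antisym R (Rxy , r) (Ryx , s) (suc i) =
  LexAll-antisym (R ∘ suc) (r Ryx) (s Rxy) i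

-- Inclusion of down-sets

lowerEM : ∀ b → ExcludedMiddle (a ⊔ b) → ExcludedMiddle a
lowerEM b em = map′ Level.lower lift (em {Lift b _})

-- An increasing family of down-sets D (f q) yields an increasing family of
-- points: take one in D (f v) but not in D (f u), for each of the disjoint
-- intervals (u , v) of ℚ.
⊆-scattered : {A : Set a} → ExcludedMiddle (a ⊔ ℓ) →
              {M : Rel A b} → IsScatteredTotalPreorder M →
              (D : X → Pred A ℓ) →
              (∀ x {v w} → M v w → D x w → D x v) →
              IsScatteredTotalPreorder (λ x y → ∀ w → D x w → D y w)
⊆-scattered {a = a} em {M} M-s D down = record
  { trans         = λ Dx⊆Dy Dy⊆Dz w → Dy⊆Dz w ∘ Dx⊆Dy w
  ; total         = ⊆-total
  ; dec           = λ _ _ → em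
  ; no-increasing = ⊆-no-increasing
  }
  where
  difference : ∀ {x y} → ¬ (∀ w → D x w → D y w) → ∃[ w ] (D x w × ¬ D y w)
  difference {x} {y} Dx⊈Dy = decidable-stable em λ none →
    Dx⊈Dy λ w w∈Dx → decidable-stable (lowerEM a em) λ w∉Dy → none (w , w∈Dx , w∉Dy)

  ⊆-total : Total (λ x y → ∀ w → D x w → D y w)
  ⊆-total x y with em {∀ w → D x w → D y w}
  ... | yes Dx⊆Dy = inj₁ Dx⊆Dy
  -- Every point of `D y` lies below `w`, since otherwise `w` would be in `D y`.
  ... | no  Dx⊈Dy with w , w∈Dx , w∉Dy ← difference Dx⊈Dy = inj₂ λ w′ w′∈Dy →
    down x (≰⇒≥ M-s (λ w≤w′ → w∉Dy (down y w≤w′ w′∈Dy))) w∈Dx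

  ⊆-no-increasing : ∀ f → ¬ Increasing (λ x y → ∀ w → D x w → D y w) f
  ⊆-no-increasing f inc = no-increasing M-s (proj₁ ∘ point) point-increasing
    where
    I : ℚ → Subinterval 0ℚ ½
    I = cell 0<½

    point : ∀ q → ∃[ w ] (D (f (upper (I q))) w × ¬ D (f (lower (I q))) w)
    point q = difference (inc (lower<upper (I q)))

    f-mono : ∀ {p q} → p ℚ.< q → ∀ w → D (f p) w → D (f q) w
    f-mono {p} {q} p<q with ⊆-total (f p) (f q)
    ... | inj₁ ⊆ = ⊆
    ... | inj₂ ⊇ = contradiction ⊇ (inc p<q)

    point-increasing : Increasing M (proj₁ ∘ point)
    point-increasing {p} {q} p<q Mqp
      with w , w∈ , _ ← point p | w′ , _ , w′∉ ← point q =
      -- If `w′` were below `w`, it would lie in the down-set at the upper end of `I p`, hence in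
      -- the one at the lower end of `I q`.
      w′∉ (f-mono (cell-mono 0<½ p<q) w′ (down _ Mqp w∈))

-- Scattered linear orders and scattered total preorders

-- A strictly increasing map on the chain ℚ reflects the order; injectivity and, by totality,
-- monotonicity follow.
linear⇒scattered : {_≈_ : Rel A ℓ₁} {_≤_ : Rel A ℓ₂} → Decidable _≤_ →
                   IsScatteredLinearOrder _≈_ _≤_ → IsScatteredTotalPreorder _≤_
linear⇒scattered {_≈_ = _≈_} {_≤_} _≤?_ lin = record
  { trans         = T.trans
  ; total         = T.total
  ; dec           = _≤?_
  ; no-increasing = λ f inc → IsScatteredLinearOrder.scattered lin (f , embedding f inc)
  }
  where
  module T = IsTotalOrder (IsScatteredLinearOrder.isTotalOrder lin)

  embedding : ∀ f → Increasing _≤_ f → IsOrderMonomorphism _≡_ _≈_ ℚ._≤_ _≤_ f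
  embedding f inc = record
    { isOrderHomomorphism = record { cong = λ { refl → T.Eq.refl } ; mono = mono }
    ; injective = λ fp≈fq → ℚ.≤-antisym (cancel (T.reflexive fp≈fq))
                                        (cancel (T.reflexive (T.Eq.sym fp≈fq)))
    ; cancel = cancel
    }
    where
    cancel : ∀ {p q} → f p ≤ f q → p ℚ.≤ q
    cancel fp≤fq = ℚ.≮⇒≥ λ q<p → inc q<p fp≤fq

    mono : ∀ {p q} → p ℚ.≤ q → f p ≤ f q
    mono {p} {q} p≤q with T.total (f p) (f q)
    ... | inj₁ fp≤fq = fp≤fq
    ... | inj₂ fq≤fp with refl ← ℚ.≤-antisym p≤q (cancel fq≤fp) = fq≤fp

-- Decidability is used to move the given relations to the universe level that
-- 𝓛ₛ<ω asks for.
scattered-realizer : (P : Poset c ℓ₁ ℓ₂) → let open Poset P in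
  ∀ {n} (K : Fin n → Rel Carrier ℓ) →
  (∀ i → IsScatteredTotalPreorder (K i)) →
  (∀ i {x y} → K i x y → K i y x → x ≈ y) →
  (∀ {x y} → x ≤ y → ∀ i → K i x y) →
  (∀ {x y} → (∀ i → K i x y) → x ≤ y) →
  𝓛ₛ<ω P
scattered-realizer {ℓ₂ = ℓ₂} P {n} K K-s K-antisym ≤⇒K K⇒≤ =
  n , L , linear , λ x y →
    mk⇔ (λ x≤y i → to i (≤⇒K x≤y i)) (λ Lxy → K⇒≤ (λ i → from i (Lxy i)))
  where
  open Poset P using (Carrier; _≈_; isEquivalence; reflexive)

  L : Fin n → Rel Carrier ℓ₂
  L i x y = Lift ℓ₂ (True (dec (K-s i) x y))

  to : ∀ i {x y} → K i x y → L i x y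
  to i = lift ∘ fromWitness

  from : ∀ i {x y} → L i x y → K i x y
  from i = toWitness ∘ Level.lower

  linear : ∀ i → IsScatteredLinearOrder _≈_ (L i)
  linear i = record
    { isTotalOrder = record
      { isPartialOrder = record
        { isPreorder = record
          { isEquivalence = isEquivalence
          ; reflexive     = λ x≈y → to i (≤⇒K (reflexive x≈y) i)
          ; trans         = λ Lxy Lyz → to i (trans (K-s i) (from i Lxy) (from i Lyz))
          }
        ; antisym = λ Lxy Lyx → K-antisym i (from i Lxy) (from i Lyx)
        }
      ; total = λ x y → Sum.map (to i) (to i) (total (K-s i) x y)
      }
    ; scattered = λ (f , mono) → no-increasing (K-s i) f λ p<q Kqp →
        ℚ.<-irrefl refl (ℚ.<-≤-trans p<q (IsOrderMonomorphism.cancel mono (to i Kqp)))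
    }

-- The two translations of realizers

module _ {c ℓ₁ ℓ₂} (em : ExcludedMiddle (c ⊔ ℓ₁ ⊔ ℓ₂)) (P : Poset c ℓ₁ ℓ₂) where

  open Poset P using (Carrier; _≈_; _≤_)
  private
    module P = Poset P
    module BP = Poset (B P)

  split-realizer : 𝓛ₛ<ω P → 𝓛ₛ<ω (B P)
  split-realizer (n , L , L-linear , L-realizes) =
    scattered-realizer (B P) K K-scattered K-antisym ≤⇒K K⇒≤
    where
    L-scattered : ∀ i → IsScatteredTotalPreorder (L i)
    L-scattered i =
      linear⇒scattered (λ _ _ → lowerEM (c ⊔ ℓ₁) em) (L-linear i)

    ≤⇒L : ∀ {x y} → x ≤ y → ∀ i → L i x y
    ≤⇒L = Equivalence.to (L-realizes _ _)

    L⇒≤ : ∀ {x y} → (∀ i → L i x y) → x ≤ y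
    L⇒≤ = Equivalence.from (L-realizes _ _)

    LexAll-L-antisym : ∀ {x y} → LexAll L x y → LexAll L y x → x ≈ y
    LexAll-L-antisym Lxy Lyx =
      P.antisym (L⇒≤ (LexAll-antisym L Lxy Lyx)) (L⇒≤ (LexAll-antisym L Lyx Lxy))

    Level≤ : Rel (Carrier × Fin 2) Level.zero
    Level≤ = Fin._≤_ on proj₂

    Level≤-scattered : IsScatteredTotalPreorder Level≤
    Level≤-scattered = on-scattered proj₂ Fin2-scattered

    K : Fin (2 ℕ.+ n) → Rel (Carrier × Fin 2) ℓ₂
    K zero          = Lex Level≤ (LexAll L on proj₁)
    K (suc zero)    = Lex Level≤ (flip (LexAll L) on proj₁)
    K (suc (suc i)) = Lex (L i on proj₁) Level≤

    K-scattered : ∀ k → IsScatteredTotalPreorder (K k)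
    K-scattered zero = Lex-scattered Level≤-scattered
      (on-scattered proj₁ (LexAll-scattered L-scattered))
    K-scattered (suc zero) = Lex-scattered Level≤-scattered
      (on-scattered proj₁ (flip-scattered (LexAll-scattered L-scattered)))
    K-scattered (suc (suc i)) =
      Lex-scattered (on-scattered proj₁ (L-scattered i)) Level≤-scattered

    K-antisym : ∀ k {u v} → K k u v → K k v u → u BP.≈ v
    K-antisym zero (i≤j , Lxy) (j≤i , Lyx) =
      LexAll-L-antisym (Lxy j≤i) (Lyx i≤j) , Fin.≤-antisym i≤j j≤i
    K-antisym (suc zero) (i≤j , Lyx) (j≤i , Lxy) =
      LexAll-L-antisym (Lxy i≤j) (Lyx j≤i) , Fin.≤-antisym i≤j j≤i
    K-antisym (suc (suc i)) (Lxy , i≤j) (Lyx , j≤i) =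
        IsTotalOrder.antisym (IsScatteredLinearOrder.isTotalOrder (L-linear i)) Lxy Lyx
      , Fin.≤-antisym (i≤j Lyx) (j≤i Lxy)

    ≤⇒K : ∀ {u v} → u BP.≤ v → ∀ k → K k u v
    ≤⇒K (inj₁ (x≤y , i<j)) zero =
      ℕ.<⇒≤ i<j , λ j≤i → contradiction j≤i (ℕ.<⇒≱ i<j)
    ≤⇒K (inj₁ (x≤y , i<j)) (suc zero) =
      ℕ.<⇒≤ i<j , λ j≤i → contradiction j≤i (ℕ.<⇒≱ i<j)
    ≤⇒K (inj₁ (x≤y , i<j)) (suc (suc k)) = ≤⇒L x≤y k , λ _ → ℕ.<⇒≤ i<j
    ≤⇒K (inj₂ (x≈y , refl)) zero =
      ℕ.≤-refl , λ _ → all⇒LexAll L (≤⇒L (P.reflexive x≈y))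
    ≤⇒K (inj₂ (x≈y , refl)) (suc zero) =
      ℕ.≤-refl , λ _ → all⇒LexAll L (≤⇒L (P.reflexive (P.Eq.sym x≈y)))
    ≤⇒K (inj₂ (x≈y , refl)) (suc (suc k)) =
      ≤⇒L (P.reflexive x≈y) k , λ _ → ℕ.≤-refl

    K⇒≤ : ∀ {u v} → (∀ k → K k u v) → u BP.≤ v
    K⇒≤ {x , i} {y , j} Kuv with Fin.<-cmp i j
    ... | tri< i<j _ _    = inj₁ (L⇒≤ (λ k → proj₁ (Kuv (suc (suc k)))) , i<j)
    -- Within one level the two opposite orders agree only on equal elements.
    ... | tri≈ _ refl _   = inj₂
      ( LexAll-L-antisym (proj₂ (Kuv zero) ℕ.≤-refl) (proj₂ (Kuv (suc zero)) ℕ.≤-refl)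
      , refl)
    ... | tri> _ _ j<i    = contradiction (proj₁ (Kuv zero)) (ℕ.<⇒≱ j<i)

  unsplit-realizer : 𝓛ₛ<ω (B P) → 𝓛ₛ<ω P
  unsplit-realizer (n , M , M-linear , M-realizes) =
    scattered-realizer P (λ i → Lex (C i) (LexAll C))
      (λ i → Lex-scattered (C-scattered i) (LexAll-scattered C-scattered))
      (λ i (Cxy , Lxy) (Cyx , Lyx) → P.antisym
        (C⇒≤ (LexAll-antisym C (Lxy Cyx) (Lyx Cxy)))
        (C⇒≤ (LexAll-antisym C (Lyx Cxy) (Lxy Cyx))))
      (λ x≤y i → ≤⇒C x≤y i , λ _ → all⇒LexAll C (≤⇒C x≤y))
      (λ Lxy → C⇒≤ (proj₁ ∘ Lxy))
    where
    M-scattered : ∀ i → IsScatteredTotalPreorder (M i)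
    M-scattered i =
      linear⇒scattered (λ _ _ → lowerEM c em) (M-linear i)

    D : Fin n → Carrier → Pred (Carrier × Fin 2) (c ⊔ ℓ₁ ⊔ ℓ₂)
    D i x w = ∃[ z ] (z ≤ x × M i w (z , zero))

    C : Fin n → Rel Carrier (c ⊔ ℓ₁ ⊔ ℓ₂)
    C i x y = ∀ w → D i x w → D i y w

    C-scattered : ∀ i → IsScatteredTotalPreorder (C i)
    C-scattered i = ⊆-scattered em (M-scattered i) (D i)
      λ x Mvw (z , z≤x , Mwz) → z , z≤x , trans (M-scattered i) Mvw Mwz

    ≤⇒C : ∀ {x y} → x ≤ y → ∀ i → C i x y
    ≤⇒C x≤y i w (z , z≤x , Mwz) = z , P.trans z≤x x≤y , Mwz

    C⇒≤ : ∀ {x y} → (∀ i → C i x y) → x ≤ y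
    C⇒≤ {x} {y} Cxy with Equivalence.from (M-realizes (x , zero) (y , suc zero)) below
      where
      below : ∀ i → M i (x , zero) (y , suc zero)
      -- The inclusion is tested at the generator `(x , zero)` of `D i x`; the `z` obtained
      -- satisfies `(z , zero) < (y , suc zero)` in `B P`.
      below i with z , z≤y , Mxz ← Cxy i _ (x , P.refl , refl′ (M-scattered i) _) =
        trans (M-scattered i) Mxz (Equivalence.to (M-realizes _ _) (inj₁ (z≤y , z<s)) i)
    -- The case of equality is absent because the two levels differ.
    ... | inj₁ (x≤y , _) = x≤y

theorem2 : ∀ {c ℓ₁ ℓ₂} → ExcludedMiddle (c ⊔ ℓ₁ ⊔ ℓ₂) →
    (P : Poset c ℓ₁ ℓ₂) → 𝓛ₛ<ω P ⇔ 𝓛ₛ<ω (B P)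
theorem2 em P = mk⇔ (split-realizer em P) (unsplit-realizer em P)
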